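{- The families of morphisms $f: I_{\mathsf{ImpBiLat}}\to FG$ and $g: I_{\mathsf{CILat}}\to GF$ given by $f_{\mathbf B}(a)=\langle a\land\top,\neg a\land\top\rangle$ for $a\in B$ and $g_{\mathbf L}(a)=\langle a,1\rangle$ for $a\in L$ are natural isomorphisms, so that the categories $\mathsf{CILat}$ and $\mathsf{ImpBiLat}$ are naturally equivalent.
   Context: A bilattice is an algebra $\langle B,\land,\lor,\otimes,\oplus,\neg\rangle$ such that $\langle B,\land,\lor\rangle$ and $\langle B,\otimes,\oplus\rangle$ are lattices (not necessarily bounded) with orders $\leq_t$ and $\leq_k$, and $\neg$ is unary with: $a\leq_t b\Rightarrow\neg b\leq_t\neg a$; $a\leq_k b\Rightarrow\neg a\leq_k\neg b$; $\neg\neg a=a$. An implicative bilattice is an algebra $\langle B,\land,\lor,\otimes,\oplus,\supset,\neg\rangle$ whose $\supset$-free reduct is a bilattice and which satisfies: (IB1) $(x\supset x)\supset y\approx y$; (IB2) $x\supset(y\supset z)\approx(x\land y)\supset z\approx(x\otimes y)\supset z$; (IB3) $((x\supset y)\supset x)\supset x\approx x\supset x$; (IB4) $(x\lor y)\supset z\approx(x\supset z)\land(y\supset z)\approx(x\oplus y)\supset z$; (IB5) $x\land((x\supset y)\supset(x\otimes y))\approx x$; (IB6) $\neg(x\supset y)\supset z\approx(x\land\neg y)\supset z$. In an implicative bilattice the term $(x\supset x)\oplus\neg(x\supset x)$ is constant; its value is denoted $\top$ and is the $\leq_k$-maximum. $\mathsf{ImpBiLat}$ is the category of implicative bilattices with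 all homomorphisms. A classical implicative lattice is a relatively complemented distributive lattice with maximum $1$, regarded as an algebra $\langle L,\sqcap,\sqcup,\backslash,1\rangle$ where $a\backslash b$ is the relative complement of $a$ in $[a\sqcap b,1]$. $\mathsf{CILat}$ is the category of classical implicative lattices with all homomorphisms (preserving $\sqcap,\sqcup,\backslash,1$). $I_{\mathsf C}$ is the identity functor of $\mathsf C$. The functor $F:\mathsf{CILat}\to\mathsf{ImpBiLat}$ sends $\mathbf L$ to the implicative bilattice $\langle\mathbf L\odot\mathbf L,\supset\rangle$ with universe $L\times L$ and operations $\langle a_1,a_2\rangle\land\langle b_1,b_2\rangle=\langle a_1\sqcap b_1,a_2\sqcup b_2\rangle$, $\langle a_1,a_2\rangle\lor\langle b_1,b_2\rangle=\langle a_1\sqcup b_1,a_2\sqcap b_2\rangle$, $\langle a_1,a_2\rangle\otimes\langle b_1,b_2\rangle=\langle a_1\sqcap b_1,a_2\sqcap b_2\rangle$, $\langle a_1,a_2\rangle\oplus\langle b_1,b_2\rangle=\langle a_1\sqcup b_1,a_2\sqcup b_2\rangle$, $\neg\langle a_1,a_2\rangle=\langle a_2,a_1\rangle$, $\langle a_1,a_2\rangle\supset\langle b_1,b_2\rangle=\langle a_1\backslash b_1,a_1\sqcap b_2\rangle$; and $F(h)(\langle a,b\rangle)=\langle h(a),h(b)\rangle$. The functor $G:\mathsf{ImpBiLat}\to\mathsf{CILat}$ sends $\mathbf B$ to the classical implicative lattice $\mathbf B^-=\langle\{a\in B: a\leq_t\top\},\land,\lor,\backslash,\top\rangle$, where $a\backslash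 b=(a\supset(a\land b))\land\top$; and $G(k)(a)=k(a)$. -}

module Defs where

open import Algebra.Core using (Op₁; Op₂)
import Algebra.Definitions as AlgebraDefinitions
open import Algebra.Lattice.Bundles using (Lattice; DistributiveLattice)
open import Algebra.Lattice.Morphism.Structures using (IsLatticeHomomorphism)
import Algebra.Lattice.Properties.DistributiveLattice as DistributiveLatticeProperties
import Algebra.Lattice.Properties.Lattice as LatticeProperties
import Algebra.Lattice.Structures as LatticeStructures
import Algebra.Lattice.Structures.Biased as BiasedStructures
import Algebra.Morphism.Definitions as MorphismDefinitions
open import Data.Product.Base using (Σ-syntax; ∃; _×_; _,_; proj₁; proj₂; swap)
open import Data.Product.Relation.Binary.Pointwise.NonDependent
  using (Pointwise; ×-isEquivalence)
open import Function.Base using (_on_)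
open import Level using (Level; suc) renaming (_⊔_ to _⊔ˡ_)
import Relation.Binary.Construct.NaturalOrder.Left as NaturalOrder
import Relation.Binary.Construct.On as On
open import Relation.Binary.Core using (Rel)
open import Relation.Binary.Definitions using (Maximum; Monotonic₁; Antitonic₁)
import Relation.Binary.Lattice as OrderTheoretic
import Relation.Binary.Reasoning.Setoid as ≈-Reasoning
open import Relation.Binary.Structures using (IsEquivalence)

record Category o h e : Set (suc (o ⊔ˡ h ⊔ˡ e)) where
  infix  4 _≈_ _⇒_
  infixr 9 _∘_
  field
    Obj           : Set o
    _⇒_           : Rel Obj h
    _≈_           : ∀ {X Y} → Rel (X ⇒ Y) e
    id            : ∀ {X} → X ⇒ X
    _∘_           : ∀ {X Y Z} → Y ⇒ Z → X ⇒ Y → X ⇒ Z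
    isEquivalence : ∀ {X Y} → IsEquivalence (_≈_ {X} {Y})
    ∘-cong        : ∀ {X Y Z} {g g′ : Y ⇒ Z} {f f′ : X ⇒ Y} →
                    g ≈ g′ → f ≈ f′ → g ∘ f ≈ g′ ∘ f′
    assoc         : ∀ {W X Y Z} (h : Y ⇒ Z) (g : X ⇒ Y) (f : W ⇒ X) →
                    (h ∘ g) ∘ f ≈ h ∘ (g ∘ f)
    identityˡ     : ∀ {X Y} (f : X ⇒ Y) → id ∘ f ≈ f
    identityʳ     : ∀ {X Y} (f : X ⇒ Y) → f ∘ id ≈ f

  record IsIso {X Y} (f : X ⇒ Y) : Set (h ⊔ˡ e) where
    field
      inverse  : Y ⇒ X
      inverseˡ : inverse ∘ f ≈ id
      inverseʳ : f ∘ inverse ≈ id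

private
  variable
    o h e o′ h′ e′ o″ h″ e″ : Level

record Functor (C : Category o h e) (D : Category o′ h′ e′)
               : Set (o ⊔ˡ h ⊔ˡ e ⊔ˡ o′ ⊔ˡ h′ ⊔ˡ e′) where
  private
    module C = Category C
    module D = Category D
  field
    F₀       : C.Obj → D.Obj
    F₁       : ∀ {X Y} → X C.⇒ Y → F₀ X D.⇒ F₀ Y
    F₁-cong  : ∀ {X Y} {f g : X C.⇒ Y} → f C.≈ g → F₁ f D.≈ F₁ g
    identity : ∀ {X} → F₁ (C.id {X}) D.≈ D.id
    homo     : ∀ {X Y Z} (g : Y C.⇒ Z) (f : X C.⇒ Y) →
               F₁ (g C.∘ f) D.≈ F₁ g D.∘ F₁ f

Id : (C : Category o h e) → Functor C C
Id C = record
  { F₀       = λ X → X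
  ; F₁       = λ f → f
  ; F₁-cong  = λ f≈g → f≈g
  ; identity = IsEquivalence.refl isEquivalence
  ; homo     = λ _ _ → IsEquivalence.refl isEquivalence
  }
  where open Category C

infixr 9 _∘F_

_∘F_ : {C : Category o h e} {D : Category o′ h′ e′} {E : Category o″ h″ e″} →
       Functor D E → Functor C D → Functor C E
_∘F_ {E = E} G F = record
  { F₀       = λ X → G.F₀ (F.F₀ X)
  ; F₁       = λ f → G.F₁ (F.F₁ f)
  ; F₁-cong  = λ f≈g → G.F₁-cong (F.F₁-cong f≈g)
  ; identity = trans (G.F₁-cong F.identity) G.identity
  ; homo     = λ g f → trans (G.F₁-cong (F.homo g f)) (G.homo (F.F₁ g) (F.F₁ f))
  }
  where
  module F = Functor F
  module G = Functor G
  trans : ∀ {X Y} {f g h : Category._⇒_ E X Y} →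
          Category._≈_ E f g → Category._≈_ E g h → Category._≈_ E f h
  trans = IsEquivalence.trans (Category.isEquivalence E)

Family : {C : Category o h e} {D : Category o′ h′ e′} →
         Functor C D → Functor C D → Set (o ⊔ˡ h′)
Family {C = C} {D = D} F G = ∀ X → Functor.F₀ F X D.⇒ Functor.F₀ G X
  where module D = Category D

record IsNaturalIsomorphism {C : Category o h e} {D : Category o′ h′ e′}
                            (F G : Functor C D) (η : Family F G)
                            : Set (o ⊔ˡ h ⊔ˡ e ⊔ˡ o′ ⊔ˡ h′ ⊔ˡ e′) where
  private
    module C = Category C
    module D = Category D
    module F = Functor F
    module G = Functor G
  field
    natural : ∀ {X Y} (k : X C.⇒ Y) → η Y D.∘ F.F₁ k D.≈ G.F₁ k D.∘ η X
    isIso   : ∀ X → D.IsIso (η X)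

NaturallyIsomorphic : {C : Category o h e} {D : Category o′ h′ e′} →
                      Functor C D → Functor C D →
                      Set (o ⊔ˡ h ⊔ˡ e ⊔ˡ o′ ⊔ˡ h′ ⊔ˡ e′)
NaturallyIsomorphic F G = Σ[ η ∈ Family F G ] IsNaturalIsomorphism F G η

record NaturallyEquivalent (C : Category o h e) (D : Category o′ h′ e′)
                           : Set (o ⊔ˡ h ⊔ˡ e ⊔ˡ o′ ⊔ˡ h′ ⊔ˡ e′) where
  field
    to      : Functor C D
    from    : Functor D C
    from∘to : NaturallyIsomorphic (Id C) (from ∘F to)
    to∘from : NaturallyIsomorphic (Id D) (to ∘F from)

module _ {a ℓ} {A : Set a} (_≈_ : Rel A ℓ) where

  open AlgebraDefinitions _≈_
  open LatticeStructures _≈_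

  record IsBilattice (_∧_ _∨_ _⊗_ _⊕_ : Op₂ A) (¬_ : Op₁ A) : Set (a ⊔ˡ ℓ) where
    field
      isLatticeₜ : IsLattice _∨_ _∧_
      isLatticeₖ : IsLattice _⊕_ _⊗_

    open NaturalOrder _≈_ _∧_ public using () renaming (_≤_ to _≤ₜ_)
    open NaturalOrder _≈_ _⊗_ public using () renaming (_≤_ to _≤ₖ_)

    field
      ¬-cong       : Congruent₁ ¬_
      ¬-antitoneₜ  : Antitonic₁ _≤ₜ_ _≤ₜ_ ¬_
      ¬-monotoneₖ  : Monotonic₁ _≤ₖ_ _≤ₖ_ ¬_
      ¬-involutive : Involutive ¬_

    open IsLattice isLatticeₜ public
    open IsLattice isLatticeₖ public using () renaming
      ( ∨-comm to ⊕-comm; ∨-assoc to ⊕-assoc; ∨-cong to ⊕-cong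
      ; ∧-comm to ⊗-comm; ∧-assoc to ⊗-assoc; ∧-cong to ⊗-cong
      ; ∨-absorbs-∧ to ⊕-absorbs-⊗; ∧-absorbs-∨ to ⊗-absorbs-⊕
      )

record ImplicativeBilattice c ℓ : Set (suc (c ⊔ˡ ℓ)) where
  infix  8 ¬_
  infixr 7 _∧_ _⊗_
  infixr 6 _∨_ _⊕_
  infixr 5 _⊃_
  infix  4 _≈_
  field
    Carrier     : Set c
    _≈_         : Rel Carrier ℓ
    _∧_         : Op₂ Carrier
    _∨_         : Op₂ Carrier
    _⊗_         : Op₂ Carrier
    _⊕_         : Op₂ Carrier
    _⊃_         : Op₂ Carrier
    ¬_          : Op₁ Carrier
    -- Universes of algebras are non-empty.  The signature has no constants,
    -- so this is not implied; homomorphisms need not preserve the point.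
    point       : Carrier
    isBilattice : IsBilattice _≈_ _∧_ _∨_ _⊗_ _⊕_ ¬_
    ⊃-cong      : AlgebraDefinitions.Congruent₂ _≈_ _⊃_
    IB1         : ∀ x y → (x ⊃ x) ⊃ y ≈ y
    IB2-∧       : ∀ x y z → x ⊃ (y ⊃ z) ≈ (x ∧ y) ⊃ z
    IB2-⊗       : ∀ x y z → (x ∧ y) ⊃ z ≈ (x ⊗ y) ⊃ z
    IB3         : ∀ x y → ((x ⊃ y) ⊃ x) ⊃ x ≈ x ⊃ x
    IB4-∨       : ∀ x y z → (x ∨ y) ⊃ z ≈ (x ⊃ z) ∧ (y ⊃ z)
    IB4-⊕       : ∀ x y z → (x ⊃ z) ∧ (y ⊃ z) ≈ (x ⊕ y) ⊃ z
    IB5         : ∀ x y → x ∧ ((x ⊃ y) ⊃ (x ⊗ y)) ≈ x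
    IB6         : ∀ x y z → ¬ (x ⊃ y) ⊃ z ≈ (x ∧ ¬ y) ⊃ z

  open IsBilattice isBilattice public

  latticeₜ latticeₖ : Lattice c ℓ
  latticeₜ = record { isLattice = isLatticeₜ }
  latticeₖ = record { isLattice = isLatticeₖ }

  open Lattice latticeₜ public using (setoid)

  -- Independent of the point: see ⊤-constant below.
  ⊤ : Carrier
  ⊤ = (point ⊃ point) ⊕ ¬ (point ⊃ point)

record ImplicativeBilatticeHom {c ℓ} (A B : ImplicativeBilattice c ℓ) : Set (c ⊔ˡ ℓ) where
  private
    module A = ImplicativeBilattice A
    module B = ImplicativeBilattice B
  open MorphismDefinitions A.Carrier B.Carrier B._≈_
  field
    ⟦_⟧    : A.Carrier → B.Carrier
    homoₜ  : IsLatticeHomomorphism (Lattice.rawLattice A.latticeₜ) (Lattice.rawLattice B.latticeₜ) ⟦_⟧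
    homoₖ  : IsLatticeHomomorphism (Lattice.rawLattice A.latticeₖ) (Lattice.rawLattice B.latticeₖ) ⟦_⟧
    ⊃-homo : Homomorphic₂ ⟦_⟧ A._⊃_ B._⊃_
    ¬-homo : Homomorphic₁ ⟦_⟧ A.¬_ B.¬_

  open IsLatticeHomomorphism homoₜ public
    using (isRelHomomorphism; ⟦⟧-cong; ∧-homo; ∨-homo)
  open IsLatticeHomomorphism homoₖ public
    using () renaming (∧-homo to ⊗-homo; ∨-homo to ⊕-homo)

module _ {c ℓ : Level} where

  open ImplicativeBilatticeHom using (⟦_⟧)

  idᴮ : {A : ImplicativeBilattice c ℓ} → ImplicativeBilatticeHom A A
  idᴮ {A} = record
    { ⟦_⟧    = λ x → x
    ; homoₜ  = record
      { isRelHomomorphism = record { cong = λ x≈y → x≈y }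
      ; ∧-homo            = λ _ _ → refl
      ; ∨-homo            = λ _ _ → refl
      }
    ; homoₖ  = record
      { isRelHomomorphism = record { cong = λ x≈y → x≈y }
      ; ∧-homo            = λ _ _ → refl
      ; ∨-homo            = λ _ _ → refl
      }
    ; ⊃-homo = λ _ _ → refl
    ; ¬-homo = λ _ → refl
    }
    where open ImplicativeBilattice A using (refl)

  _∘ᴮ_ : {A B C : ImplicativeBilattice c ℓ} →
         ImplicativeBilatticeHom B C → ImplicativeBilatticeHom A B → ImplicativeBilatticeHom A C
  _∘ᴮ_ {C = C} g f = record
    { ⟦_⟧    = λ x → ⟦ g ⟧ (⟦ f ⟧ x)
    ; homoₜ  = record
      { isRelHomomorphism = record { cong = λ x≈y → g.⟦⟧-cong (f.⟦⟧-cong x≈y) }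
      ; ∧-homo            = λ x y → trans (g.⟦⟧-cong (f.∧-homo x y)) (g.∧-homo _ _)
      ; ∨-homo            = λ x y → trans (g.⟦⟧-cong (f.∨-homo x y)) (g.∨-homo _ _)
      }
    ; homoₖ  = record
      { isRelHomomorphism = record { cong = λ x≈y → g.⟦⟧-cong (f.⟦⟧-cong x≈y) }
      ; ∧-homo            = λ x y → trans (g.⟦⟧-cong (f.⊗-homo x y)) (g.⊗-homo _ _)
      ; ∨-homo            = λ x y → trans (g.⟦⟧-cong (f.⊕-homo x y)) (g.⊕-homo _ _)
      }
    ; ⊃-homo = λ x y → trans (g.⟦⟧-cong (f.⊃-homo x y)) (g.⊃-homo _ _)
    ; ¬-homo = λ x → trans (g.⟦⟧-cong (f.¬-homo x)) (g.¬-homo _)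
    }
    where
    open ImplicativeBilattice C using (trans)
    module f = ImplicativeBilatticeHom f
    module g = ImplicativeBilatticeHom g

  _≈ᴮ_ : {A B : ImplicativeBilattice c ℓ} → Rel (ImplicativeBilatticeHom A B) (c ⊔ˡ ℓ)
  _≈ᴮ_ {B = B} f g = ∀ x → ⟦ f ⟧ x ≈ ⟦ g ⟧ x
    where open ImplicativeBilattice B using (_≈_)

  ≈ᴮ-isEquivalence : {A B : ImplicativeBilattice c ℓ} → IsEquivalence (_≈ᴮ_ {A} {B})
  ≈ᴮ-isEquivalence {B = B} = record
    { refl  = λ _ → refl
    ; sym   = λ f≈g x → sym (f≈g x)
    ; trans = λ f≈g g≈h x → trans (f≈g x) (g≈h x)
    }
    where open ImplicativeBilattice B using (refl; sym; trans)

ImpBiLat : ∀ c ℓ → Category (suc (c ⊔ˡ ℓ)) (c ⊔ˡ ℓ) (c ⊔ˡ ℓ)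
ImpBiLat c ℓ = record
  { Obj           = ImplicativeBilattice c ℓ
  ; _⇒_           = ImplicativeBilatticeHom
  ; _≈_           = _≈ᴮ_
  ; id            = idᴮ
  ; _∘_           = _∘ᴮ_
  ; isEquivalence = ≈ᴮ-isEquivalence
  ; ∘-cong        = λ {_} {_} {C} {g} {_} {_} {f′} g≈g′ f≈f′ x →
    ImplicativeBilattice.trans C (ImplicativeBilatticeHom.⟦⟧-cong g (f≈f′ x)) (g≈g′ (⟦ f′ ⟧ x))
  ; assoc         = λ {_} {_} {_} {Z} _ _ _ _ → ImplicativeBilattice.refl Z
  ; identityˡ     = λ {_} {Y} _ _ → ImplicativeBilattice.refl Y
  ; identityʳ     = λ {_} {Y} _ _ → ImplicativeBilattice.refl Y
  }
  where open ImplicativeBilatticeHom using (⟦_⟧)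

module _ {c ℓ} (L : Lattice c ℓ) where

  open Lattice L
  open NaturalOrder _≈_ _∧_ using (_≤_)

  -- The two equations force y to lie in the interval [ a , b ].
  IsRelativeComplement : (a b x y : Carrier) → Set ℓ
  IsRelativeComplement a b x y = x ∧ y ≈ a × x ∨ y ≈ b

  RelativelyComplemented : Set (c ⊔ˡ ℓ)
  RelativelyComplemented =
    ∀ {a b x} → a ≤ x → x ≤ b → ∃ λ y → IsRelativeComplement a b x y

record ClassicalImplicativeLattice c ℓ : Set (suc (c ⊔ˡ ℓ)) where
  infixr 7 _⊓_
  infixr 6 _⊔_
  infixr 5 _∖_
  infix  4 _≈_
  field
    Carrier               : Set c
    _≈_                   : Rel Carrier ℓ
    _⊓_                   : Op₂ Carrier
    _⊔_                   : Op₂ Carrier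
    _∖_                   : Op₂ Carrier
    1#                    : Carrier
    isDistributiveLattice : LatticeStructures.IsDistributiveLattice _≈_ _⊔_ _⊓_

  open LatticeStructures.IsDistributiveLattice isDistributiveLattice public
    renaming
    ( ∨-comm to ⊔-comm; ∨-assoc to ⊔-assoc; ∨-cong to ⊔-cong
    ; ∧-comm to ⊓-comm; ∧-assoc to ⊓-assoc; ∧-cong to ⊓-cong
    ; ∨-absorbs-∧ to ⊔-absorbs-⊓; ∧-absorbs-∨ to ⊓-absorbs-⊔
    ; ∧-distribˡ-∨ to ⊓-distribˡ-⊔; ∧-distribʳ-∨ to ⊓-distribʳ-⊔
    ; ∨-distribˡ-∧ to ⊔-distribˡ-⊓; ∨-distribʳ-∧ to ⊔-distribʳ-⊓
    ; ∧-congˡ to ⊓-congˡ; ∧-congʳ to ⊓-congʳ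
    ; ∨-congˡ to ⊔-congˡ; ∨-congʳ to ⊔-congʳ
    )
  open NaturalOrder _≈_ _⊓_ public using (_≤_)

  distributiveLattice : DistributiveLattice c ℓ
  distributiveLattice = record { isDistributiveLattice = isDistributiveLattice }

  open DistributiveLattice distributiveLattice public using (lattice; setoid)

  field
    1-maximum              : Maximum _≤_ 1#
    relativelyComplemented : RelativelyComplemented lattice
    ∖-cong                 : AlgebraDefinitions.Congruent₂ _≈_ _∖_
    ∖-relativeComplement   : ∀ a b → IsRelativeComplement lattice (a ⊓ b) 1# a (a ∖ b)

record ClassicalImplicativeLatticeHom {c ℓ} (L M : ClassicalImplicativeLattice c ℓ)
                                      : Set (c ⊔ˡ ℓ) where
  private
    module L = ClassicalImplicativeLattice L
    module M = ClassicalImplicativeLattice M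
  open MorphismDefinitions L.Carrier M.Carrier M._≈_
  field
    ⟦_⟧         : L.Carrier → M.Carrier
    latticeHomo : IsLatticeHomomorphism (Lattice.rawLattice L.lattice) (Lattice.rawLattice M.lattice) ⟦_⟧
    ∖-homo      : Homomorphic₂ ⟦_⟧ L._∖_ M._∖_
    1-homo      : Homomorphic₀ ⟦_⟧ L.1# M.1#

  open IsLatticeHomomorphism latticeHomo public
    using (isRelHomomorphism; ⟦⟧-cong) renaming (∧-homo to ⊓-homo; ∨-homo to ⊔-homo)

module _ {c ℓ : Level} where

  open ClassicalImplicativeLatticeHom using (⟦_⟧)

  idᴸ : {L : ClassicalImplicativeLattice c ℓ} → ClassicalImplicativeLatticeHom L L
  idᴸ {L} = record
    { ⟦_⟧         = λ x → x
    ; latticeHomo = record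
      { isRelHomomorphism = record { cong = λ x≈y → x≈y }
      ; ∧-homo            = λ _ _ → refl
      ; ∨-homo            = λ _ _ → refl
      }
    ; ∖-homo      = λ _ _ → refl
    ; 1-homo      = refl
    }
    where open ClassicalImplicativeLattice L using (refl)

  _∘ᴸ_ : {L M N : ClassicalImplicativeLattice c ℓ} →
         ClassicalImplicativeLatticeHom M N → ClassicalImplicativeLatticeHom L M →
         ClassicalImplicativeLatticeHom L N
  _∘ᴸ_ {N = N} g f = record
    { ⟦_⟧         = λ x → ⟦ g ⟧ (⟦ f ⟧ x)
    ; latticeHomo = record
      { isRelHomomorphism = record { cong = λ x≈y → g.⟦⟧-cong (f.⟦⟧-cong x≈y) }
      ; ∧-homo            = λ x y → trans (g.⟦⟧-cong (f.⊓-homo x y)) (g.⊓-homo _ _)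
      ; ∨-homo            = λ x y → trans (g.⟦⟧-cong (f.⊔-homo x y)) (g.⊔-homo _ _)
      }
    ; ∖-homo      = λ x y → trans (g.⟦⟧-cong (f.∖-homo x y)) (g.∖-homo _ _)
    ; 1-homo      = trans (g.⟦⟧-cong f.1-homo) g.1-homo
    }
    where
    open ClassicalImplicativeLattice N using (trans)
    module f = ClassicalImplicativeLatticeHom f
    module g = ClassicalImplicativeLatticeHom g

  _≈ᴸ_ : {L M : ClassicalImplicativeLattice c ℓ} →
         Rel (ClassicalImplicativeLatticeHom L M) (c ⊔ˡ ℓ)
  _≈ᴸ_ {M = M} f g = ∀ x → ⟦ f ⟧ x ≈ ⟦ g ⟧ x
    where open ClassicalImplicativeLattice M using (_≈_)

  ≈ᴸ-isEquivalence : {L M : ClassicalImplicativeLattice c ℓ} → IsEquivalence (_≈ᴸ_ {L} {M})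
  ≈ᴸ-isEquivalence {M = M} = record
    { refl  = λ _ → refl
    ; sym   = λ f≈g x → sym (f≈g x)
    ; trans = λ f≈g g≈h x → trans (f≈g x) (g≈h x)
    }
    where open ClassicalImplicativeLattice M using (refl; sym; trans)

CILat : ∀ c ℓ → Category (suc (c ⊔ˡ ℓ)) (c ⊔ˡ ℓ) (c ⊔ˡ ℓ)
CILat c ℓ = record
  { Obj           = ClassicalImplicativeLattice c ℓ
  ; _⇒_           = ClassicalImplicativeLatticeHom
  ; _≈_           = _≈ᴸ_
  ; id            = idᴸ
  ; _∘_           = _∘ᴸ_
  ; isEquivalence = ≈ᴸ-isEquivalence
  ; ∘-cong        = λ {_} {_} {N} {g} {_} {_} {f′} g≈g′ f≈f′ x →
    ClassicalImplicativeLattice.trans N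
      (ClassicalImplicativeLatticeHom.⟦⟧-cong g (f≈f′ x)) (g≈g′ (⟦ f′ ⟧ x))
  ; assoc         = λ {_} {_} {_} {N} _ _ _ _ → ClassicalImplicativeLattice.refl N
  ; identityˡ     = λ {_} {M} _ _ → ClassicalImplicativeLattice.refl M
  ; identityʳ     = λ {_} {M} _ _ → ClassicalImplicativeLattice.refl M
  }
  where open ClassicalImplicativeLatticeHom using (⟦_⟧)

module ClassicalImplicativeLatticeProperties {c ℓ} (L : ClassicalImplicativeLattice c ℓ) where

  open ClassicalImplicativeLattice L
  open LatticeProperties lattice public
    using (∨-∧-orderTheoreticLattice) renaming (∧-idem to ⊓-idem)
  open OrderTheoretic.Lattice ∨-∧-orderTheoreticLattice public
    using (antisym; x∧y≤x; x∧y≤y; ∧-greatest; x≤x∨y; y≤x∨y; ∨-least)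
    renaming (refl to ≤-refl; trans to ≤-trans; reflexive to ≤-reflexive)

  ⊓-∖ : ∀ a b → a ⊓ (a ∖ b) ≈ a ⊓ b
  ⊓-∖ a b = proj₁ (∖-relativeComplement a b)

  ⊔-∖ : ∀ a b → a ⊔ (a ∖ b) ≈ 1#
  ⊔-∖ a b = proj₂ (∖-relativeComplement a b)

  identityˡ : ∀ x → 1# ⊓ x ≈ x
  identityˡ x = trans (⊓-comm 1# x) (sym (1-maximum x))

  uncurry : ∀ {x a b} → x ≤ (a ∖ b) → x ⊓ a ≤ b
  uncurry {x} {a} {b} x≤a∖b = ≤-trans
    (∧-greatest (x∧y≤y x a) (≤-trans (x∧y≤x x a) x≤a∖b))
    (≤-trans (≤-reflexive (⊓-∖ a b)) (x∧y≤y a b))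

  decompose : ∀ x a b → x ≈ (x ⊓ a) ⊔ (x ⊓ (a ∖ b))
  decompose x a b = begin
    x                           ≈⟨ 1-maximum x ⟩
    x ⊓ 1#                      ≈⟨ ⊓-congˡ (⊔-∖ a b) ⟨
    x ⊓ (a ⊔ (a ∖ b))          ≈⟨ ⊓-distribˡ-⊔ x a (a ∖ b) ⟩
    (x ⊓ a) ⊔ (x ⊓ (a ∖ b))    ∎
    where open ≈-Reasoning setoid

  curry : ∀ {x a b} → x ⊓ a ≤ b → x ≤ (a ∖ b)
  curry {x} {a} {b} x⊓a≤b = ≤-trans (≤-reflexive (decompose x a b)) (∨-least
    (≤-trans (∧-greatest (x∧y≤y x a) x⊓a≤b)
             (≤-trans (≤-reflexive (sym (⊓-∖ a b))) (x∧y≤y a (a ∖ b))))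
    (x∧y≤y x (a ∖ b)))

  ∖-diag : ∀ x → x ∖ x ≈ 1#
  ∖-diag x = antisym (1-maximum _) (curry (x∧y≤y 1# x))

  ∖-currying : ∀ x y z → x ∖ (y ∖ z) ≈ (x ⊓ y) ∖ z
  ∖-currying x y z = antisym
    (curry (≤-trans (≤-reflexive (sym (⊓-assoc _ x y))) (uncurry (uncurry ≤-refl))))
    (curry (curry (≤-trans (≤-reflexive (⊓-assoc _ x y)) (uncurry ≤-refl))))

  ∖-peirce : ∀ x y → (x ∖ y) ∖ x ≈ x
  ∖-peirce x y = antisym
    (≤-trans (≤-reflexive (decompose _ x y)) (∨-least (x∧y≤y _ x) (uncurry ≤-refl)))
    (curry (x∧y≤x x _))

  ∖-⊔ : ∀ x y z → (x ⊔ y) ∖ z ≈ (x ∖ z) ⊓ (y ∖ z)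
  ∖-⊔ x y z = antisym
    (∧-greatest
      (curry (≤-trans (monoʳ (x≤x∨y x y)) (uncurry ≤-refl)))
      (curry (≤-trans (monoʳ (y≤x∨y x y)) (uncurry ≤-refl))))
    (curry (≤-trans (≤-reflexive (⊓-distribˡ-⊔ _ x y)) (∨-least
      (uncurry (x∧y≤x _ _)) (uncurry (x∧y≤y _ _)))))
    where
    monoʳ : ∀ {u v w} → u ≤ v → w ⊓ u ≤ w ⊓ v
    monoʳ {u} {v} {w} u≤v = ∧-greatest (x∧y≤x w u) (≤-trans (x∧y≤y w u) u≤v)

module _ {c ℓ} (L : ClassicalImplicativeLattice c ℓ) where

  open ClassicalImplicativeLattice L
  open ClassicalImplicativeLatticeProperties L

  F-obj : ImplicativeBilattice c ℓ
  F-obj = record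
    { Carrier     = Carrier × Carrier
    ; _≈_         = Pointwise _≈_ _≈_
    ; _∧_         = λ (a₁ , a₂) (b₁ , b₂) → (a₁ ⊓ b₁ , a₂ ⊔ b₂)
    ; _∨_         = λ (a₁ , a₂) (b₁ , b₂) → (a₁ ⊔ b₁ , a₂ ⊓ b₂)
    ; _⊗_         = λ (a₁ , a₂) (b₁ , b₂) → (a₁ ⊓ b₁ , a₂ ⊓ b₂)
    ; _⊕_         = λ (a₁ , a₂) (b₁ , b₂) → (a₁ ⊔ b₁ , a₂ ⊔ b₂)
    ; _⊃_         = λ (a₁ , a₂) (b₁ , b₂) → (a₁ ∖ b₁ , a₁ ⊓ b₂)
    ; ¬_          = λ (a₁ , a₂) → (a₂ , a₁)
    ; point       = 1# , 1#
    ; isBilattice = record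
      { isLatticeₜ   = record
        { isEquivalence = ×-isEquivalence isEquivalence isEquivalence
        ; ∨-comm        = λ x y → ⊔-comm _ _ , ⊓-comm _ _
        ; ∨-assoc       = λ x y z → ⊔-assoc _ _ _ , ⊓-assoc _ _ _
        ; ∨-cong        = λ p q → ⊔-cong (proj₁ p) (proj₁ q) , ⊓-cong (proj₂ p) (proj₂ q)
        ; ∧-comm        = λ x y → ⊓-comm _ _ , ⊔-comm _ _
        ; ∧-assoc       = λ x y z → ⊓-assoc _ _ _ , ⊔-assoc _ _ _
        ; ∧-cong        = λ p q → ⊓-cong (proj₁ p) (proj₁ q) , ⊔-cong (proj₂ p) (proj₂ q)
        ; absorptive    = (λ x y → ⊔-absorbs-⊓ _ _ , ⊓-absorbs-⊔ _ _)
                        , (λ x y → ⊓-absorbs-⊔ _ _ , ⊔-absorbs-⊓ _ _)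
        }
      ; isLatticeₖ   = record
        { isEquivalence = ×-isEquivalence isEquivalence isEquivalence
        ; ∨-comm        = λ x y → ⊔-comm _ _ , ⊔-comm _ _
        ; ∨-assoc       = λ x y z → ⊔-assoc _ _ _ , ⊔-assoc _ _ _
        ; ∨-cong        = λ p q → ⊔-cong (proj₁ p) (proj₁ q) , ⊔-cong (proj₂ p) (proj₂ q)
        ; ∧-comm        = λ x y → ⊓-comm _ _ , ⊓-comm _ _
        ; ∧-assoc       = λ x y z → ⊓-assoc _ _ _ , ⊓-assoc _ _ _
        ; ∧-cong        = λ p q → ⊓-cong (proj₁ p) (proj₁ q) , ⊓-cong (proj₂ p) (proj₂ q)
        ; absorptive    = (λ x y → ⊔-absorbs-⊓ _ _ , ⊔-absorbs-⊓ _ _)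
                        , (λ x y → ⊓-absorbs-⊔ _ _ , ⊓-absorbs-⊔ _ _)
        }
      ; ¬-cong       = swap
      ; ¬-antitoneₜ  = λ (p₁ , p₂) → join⇒meet p₂ , meet⇒join p₁
      ; ¬-monotoneₖ  = swap
      ; ¬-involutive = λ _ → refl , refl
      }
    ; ⊃-cong      = λ p q → ∖-cong (proj₁ p) (proj₁ q) , ⊓-cong (proj₁ p) (proj₂ q)
    ; IB1         = λ (x₁ , x₂) (y₁ , y₂) →
                      trans (∖-cong (∖-diag x₁) refl) (1-∖ y₁) ,
                      trans (⊓-congʳ (∖-diag x₁)) (identityˡ y₂)
    ; IB2-∧       = λ (x₁ , _) (y₁ , _) (z₁ , z₂) →
                      ∖-currying x₁ y₁ z₁ , sym (⊓-assoc x₁ y₁ z₂)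
    ; IB2-⊗       = λ _ _ _ → refl , refl
    ; IB3         = λ (x₁ , _) (y₁ , _) →
                      ∖-cong (∖-peirce x₁ y₁) refl , ⊓-congʳ (∖-peirce x₁ y₁)
    ; IB4-∨       = λ (x₁ , _) (y₁ , _) (z₁ , z₂) →
                      ∖-⊔ x₁ y₁ z₁ , ⊓-distribʳ-⊔ z₂ x₁ y₁
    ; IB4-⊕       = λ (x₁ , _) (y₁ , _) (z₁ , z₂) →
                      sym (∖-⊔ x₁ y₁ z₁) , sym (⊓-distribʳ-⊔ z₂ x₁ y₁)
    ; IB5         = λ (x₁ , x₂) (y₁ , y₂) →
                      sym (curry (≤-reflexive (⊓-∖ x₁ y₁))) ,
                      sym (meet⇒join (≤-trans (x∧y≤y _ _) (x∧y≤x x₂ y₂)))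
    ; IB6         = λ _ _ _ → refl , refl
    }
    where
    join⇒meet : ∀ {a b} → a ≈ a ⊔ b → b ≤ a
    join⇒meet {a} {b} p = ≤-trans (y≤x∨y a b) (≤-reflexive (sym p))
    meet⇒join : ∀ {a b} → a ≤ b → b ≈ b ⊔ a
    meet⇒join {a} {b} p = antisym (x≤x∨y b a) (∨-least ≤-refl p)
    1-∖ : ∀ y → 1# ∖ y ≈ y
    1-∖ y = antisym (≤-trans (≤-reflexive (1-maximum _)) (uncurry ≤-refl)) (curry (x∧y≤x y 1#))

module _ {c ℓ} {L M : ClassicalImplicativeLattice c ℓ}
         (h : ClassicalImplicativeLatticeHom L M) where

  open ClassicalImplicativeLatticeHom h
  open ClassicalImplicativeLattice M using (refl)

  F-hom : ImplicativeBilatticeHom (F-obj L) (F-obj M)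
  F-hom = record
    { ⟦_⟧    = λ (a , b) → (⟦ a ⟧ , ⟦ b ⟧)
    ; homoₜ  = record
      { isRelHomomorphism = record { cong = λ (p , q) → ⟦⟧-cong p , ⟦⟧-cong q }
      ; ∧-homo            = λ _ _ → ⊓-homo _ _ , ⊔-homo _ _
      ; ∨-homo            = λ _ _ → ⊔-homo _ _ , ⊓-homo _ _
      }
    ; homoₖ  = record
      { isRelHomomorphism = record { cong = λ (p , q) → ⟦⟧-cong p , ⟦⟧-cong q }
      ; ∧-homo            = λ _ _ → ⊓-homo _ _ , ⊓-homo _ _
      ; ∨-homo            = λ _ _ → ⊔-homo _ _ , ⊔-homo _ _
      }
    ; ⊃-homo = λ _ _ → ∖-homo _ _ , ⊓-homo _ _
    ; ¬-homo = λ _ → refl , refl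
    }

F : ∀ c ℓ → Functor (CILat c ℓ) (ImpBiLat c ℓ)
F c ℓ = record
  { F₀       = F-obj
  ; F₁       = F-hom
  ; F₁-cong  = λ h≈h′ (a , b) → h≈h′ a , h≈h′ b
  ; identity = λ {L} _ → IsEquivalence.refl (ImplicativeBilattice.isEquivalence (F-obj L))
  ; homo     = λ {_} {_} {N} _ _ _ → IsEquivalence.refl (ImplicativeBilattice.isEquivalence (F-obj N))
  }

module ImplicativeBilatticeProperties {c ℓ} (B : ImplicativeBilattice c ℓ) where

  open ImplicativeBilattice B
  open OrderTheoretic.Lattice (LatticeProperties.∨-∧-orderTheoreticLattice latticeₜ) public
    using () renaming
    ( refl to ≤ₜ-refl; trans to ≤ₜ-trans; reflexive to ≤ₜ-reflexive; antisym to ≤ₜ-antisym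
    ; x∧y≤x to x∧y≤ₜx; x∧y≤y to x∧y≤ₜy; ∧-greatest to ∧-greatestₜ; ∨-least to ∨-leastₜ
    ; y≤x∨y to y≤ₜx∨y )
  open OrderTheoretic.Lattice (LatticeProperties.∨-∧-orderTheoreticLattice latticeₖ) public
    using () renaming
    ( trans to ≤ₖ-trans; reflexive to ≤ₖ-reflexive; antisym to ≤ₖ-antisym
    ; x∧y≤x to x⊗y≤ₖx; x∧y≤y to x⊗y≤ₖy; ∧-greatest to ⊗-greatestₖ
    ; x≤x∨y to x≤ₖx⊕y; y≤x∨y to y≤ₖx⊕y )

  -- In L ⊙ L, x ~ y says that x and y have the same first component, and D x
  -- that the first component of x is 1.

  infix 4 _~_

  _~_ : Rel Carrier (c ⊔ˡ ℓ)
  x ~ y = ∀ z → x ⊃ z ≈ y ⊃ z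

  D : Carrier → Set (c ⊔ˡ ℓ)
  D x = ∀ z → x ⊃ z ≈ z

  ~-isEquivalence : IsEquivalence _~_
  ~-isEquivalence = record
    { refl  = λ _ → refl
    ; sym   = λ x~y z → sym (x~y z)
    ; trans = λ w~x x~y z → trans (w~x z) (x~y z)
    }

  open IsEquivalence ~-isEquivalence public using ()
    renaming (refl to ~-refl; sym to ~-sym; trans to ~-trans)

  ≈⇒~ : ∀ {x y} → x ≈ y → x ~ y
  ≈⇒~ x≈y z = ⊃-cong x≈y refl

  ∧-resp-~ : ∀ {x x′ y y′} → x ~ x′ → y ~ y′ → x ∧ y ~ x′ ∧ y′
  ∧-resp-~ {x} {x′} {y} {y′} x~x′ y~y′ z = begin
    (x ∧ y) ⊃ z     ≈⟨ IB2-∧ x y z ⟨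
    x ⊃ (y ⊃ z)     ≈⟨ ⊃-cong refl (y~y′ z) ⟩
    x ⊃ (y′ ⊃ z)    ≈⟨ x~x′ (y′ ⊃ z) ⟩
    x′ ⊃ (y′ ⊃ z)   ≈⟨ IB2-∧ x′ y′ z ⟩
    (x′ ∧ y′) ⊃ z   ∎
    where open ≈-Reasoning setoid

  ∨-resp-~ : ∀ {x x′ y y′} → x ~ x′ → y ~ y′ → x ∨ y ~ x′ ∨ y′
  ∨-resp-~ {x} {x′} {y} {y′} x~x′ y~y′ z = begin
    (x ∨ y) ⊃ z             ≈⟨ IB4-∨ x y z ⟩
    (x ⊃ z) ∧ (y ⊃ z)       ≈⟨ ∧-cong (x~x′ z) (y~y′ z) ⟩
    (x′ ⊃ z) ∧ (y′ ⊃ z)     ≈⟨ IB4-∨ x′ y′ z ⟨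
    (x′ ∨ y′) ⊃ z           ∎
    where open ≈-Reasoning setoid

  ∧~⊗ : ∀ x y → x ∧ y ~ x ⊗ y
  ∧~⊗ = IB2-⊗

  ~-lattice : Lattice c (c ⊔ˡ ℓ)
  ~-lattice = record
    { _≈_       = _~_
    ; _∨_       = _∨_
    ; _∧_       = _∧_
    ; isLattice = record
      { isEquivalence = ~-isEquivalence
      ; ∨-comm        = λ x y → ≈⇒~ (∨-comm x y)
      ; ∨-assoc       = λ x y z → ≈⇒~ (∨-assoc x y z)
      ; ∨-cong        = ∨-resp-~
      ; ∧-comm        = λ x y → ≈⇒~ (∧-comm x y)
      ; ∧-assoc       = λ x y z → ≈⇒~ (∧-assoc x y z)
      ; ∧-cong        = ∧-resp-~
      ; absorptive    = (λ x y → ≈⇒~ (∨-absorbs-∧ x y)) , (λ x y → ≈⇒~ (∧-absorbs-∨ x y))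
      }
    }

  open OrderTheoretic.Lattice (LatticeProperties.∨-∧-orderTheoreticLattice ~-lattice) public
    using (x∧y≤x; x∧y≤y; ∧-greatest; x≤x∨y; y≤x∨y; ∨-least)
    renaming (_≤_ to _≼_; refl to ≼-refl; trans to ≼-trans; reflexive to ≼-reflexive;
              antisym to ≼-antisym)

  ≤ₜ⇒≼ : ∀ {x y} → x ≤ₜ y → x ≼ y
  ≤ₜ⇒≼ = ≈⇒~

  ≤ₖ⇒≼ : ∀ {x y} → x ≤ₖ y → x ≼ y
  ≤ₖ⇒≼ {x} {y} x≤y = ~-trans (≈⇒~ x≤y) (~-sym (∧~⊗ x y))

  D-⊃ : ∀ x → D (x ⊃ x)
  D-⊃ = IB1

  D-up : ∀ {x y} → x ≼ y → D x → D y
  D-up {x} {y} x≼y Dx z = begin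
    y ⊃ z         ≈⟨ Dx (y ⊃ z) ⟨
    x ⊃ (y ⊃ z)   ≈⟨ IB2-∧ x y z ⟩
    (x ∧ y) ⊃ z   ≈⟨ x≼y z ⟨
    x ⊃ z         ≈⟨ Dx z ⟩
    z             ∎
    where open ≈-Reasoning setoid

  D⇒≼ : ∀ {x y} → D y → x ≼ y
  D⇒≼ {x} {y} Dy z = trans (⊃-cong refl (sym (Dy z))) (IB2-∧ x y z)

  ⊃⇒≤ₜ : ∀ {x y} → D (x ⊃ y) → x ≤ₜ x ⊗ y
  ⊃⇒≤ₜ {x} {y} D⊃ = trans (sym (IB5 x y)) (∧-cong refl (D⊃ (x ⊗ y)))

  ⊃⇒≼ : ∀ {x y} → D (x ⊃ y) → x ≼ y
  ⊃⇒≼ {x} {y} D⊃ = ≼-trans (≤ₜ⇒≼ (⊃⇒≤ₜ D⊃))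
    (≼-trans (≼-reflexive (~-sym (∧~⊗ x y))) (x∧y≤y x y))

  ≼⇒⊃ : ∀ {x y} → x ≼ y → D (x ⊃ y)
  ≼⇒⊃ {x} {y} x≼y = D-up (≤ₜ⇒≼ y⊃y≤x⊃y) (D-⊃ y)
    where
    open ≈-Reasoning setoid
    y⊃y≤x⊃y : y ⊃ y ≤ₜ x ⊃ y
    y⊃y≤x⊃y = begin
      y ⊃ y                       ≈⟨ ⊃-cong (∨-absorbs-∧ y x) refl ⟨
      (y ∨ (y ∧ x)) ⊃ y           ≈⟨ IB4-∨ y (y ∧ x) y ⟩
      (y ⊃ y) ∧ ((y ∧ x) ⊃ y)     ≈⟨ ∧-cong refl (⊃-cong (∧-comm y x) refl) ⟩
      (y ⊃ y) ∧ ((x ∧ y) ⊃ y)     ≈⟨ ∧-cong refl (x≼y y) ⟨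
      (y ⊃ y) ∧ (x ⊃ y)           ∎

  curry : ∀ {x y z} → x ∧ y ≼ z → x ≼ y ⊃ z
  curry {x} {y} {z} p = ⊃⇒≼ (D-up (≼-reflexive (≈⇒~ (sym (IB2-∧ x y z)))) (≼⇒⊃ p))

  uncurry : ∀ {x y z} → x ≼ y ⊃ z → x ∧ y ≼ z
  uncurry {x} {y} {z} p = ⊃⇒≼ (D-up (≼-reflexive (≈⇒~ (IB2-∧ x y z))) (≼⇒⊃ p))

  peirce : ∀ x y → (x ⊃ y) ⊃ x ≼ x
  peirce x y = ⊃⇒≼ (D-up (≼-reflexive (≈⇒~ (sym (IB3 x y)))) (D-⊃ x))

  ∧-monoʳ : ∀ {x y z} → y ≼ z → x ∧ y ≼ x ∧ z
  ∧-monoʳ {x} {y} y≼z = ∧-greatest (x∧y≤x x y) (≼-trans (x∧y≤y x y) y≼z)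

  ∧-distribˡ-∨-~ : ∀ x y z → x ∧ (y ∨ z) ~ (x ∧ y) ∨ (x ∧ z)
  ∧-distribˡ-∨-~ x y z = ≼-antisym
    (≼-trans (≼-reflexive (≈⇒~ (∧-comm x (y ∨ z)))) (uncurry (∨-least
      (curry (≼-trans (≼-reflexive (≈⇒~ (∧-comm y x))) (x≤x∨y _ _)))
      (curry (≼-trans (≼-reflexive (≈⇒~ (∧-comm z x))) (y≤x∨y _ _))))))
    (∨-least (∧-monoʳ (x≤x∨y y z)) (∧-monoʳ (y≤x∨y y z)))

  ¬-⊗ : ∀ x y → ¬ (¬ x ⊗ ¬ y) ≈ x ⊗ y
  ¬-⊗ x y = ≤ₖ-antisym
    (⊗-greatestₖ
      (≤ₖ-trans (¬-monotoneₖ (x⊗y≤ₖx _ _)) (≤ₖ-reflexive (¬-involutive x)))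
      (≤ₖ-trans (¬-monotoneₖ (x⊗y≤ₖy _ _)) (≤ₖ-reflexive (¬-involutive y))))
    (≤ₖ-trans (≤ₖ-reflexive (sym (¬-involutive (x ⊗ y))))
      (¬-monotoneₖ (⊗-greatestₖ (¬-monotoneₖ (x⊗y≤ₖx x y)) (¬-monotoneₖ (x⊗y≤ₖy x y)))))

  ~-¬~⇒≈ : ∀ {x y} → x ~ y → ¬ x ~ ¬ y → x ≈ y
  ~-¬~⇒≈ {x} {y} x~y ¬x~¬y = ≤ₜ-antisym
    (≤ₜ-trans (≤-⊗ x~y) (≤ₜ-trans (≤ₜ-reflexive (⊗-comm x y)) (⊗-≤ (~-sym ¬x~¬y))))
    (≤ₜ-trans (≤-⊗ (~-sym x~y)) (≤ₜ-trans (≤ₜ-reflexive (⊗-comm y x)) (⊗-≤ ¬x~¬y)))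
    where
    ≤-⊗ : ∀ {u v} → u ~ v → u ≤ₜ u ⊗ v
    ≤-⊗ u~v = ⊃⇒≤ₜ (≼⇒⊃ (≼-reflexive u~v))
    ⊗-≤ : ∀ {u v} → ¬ u ~ ¬ v → u ⊗ v ≤ₜ u
    ⊗-≤ {u} {v} ¬u~¬v = ≤ₜ-trans (≤ₜ-reflexive (sym (¬-⊗ u v)))
      (≤ₜ-trans (¬-antitoneₜ (≤-⊗ ¬u~¬v)) (≤ₜ-reflexive (¬-involutive u)))

  D-⊕¬ : ∀ {x} → D x → D (x ⊕ ¬ x)
  D-⊕¬ {x} = D-up (≤ₖ⇒≼ (x≤ₖx⊕y x (¬ x)))

  D-¬⊕¬ : ∀ {x} → D x → D (¬ (x ⊕ ¬ x))
  D-¬⊕¬ {x} = D-up (≤ₖ⇒≼ (≤ₖ-trans (≤ₖ-reflexive (sym (¬-involutive x)))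
                                   (¬-monotoneₖ (y≤ₖx⊕y x (¬ x)))))

  D⇒~ : ∀ {x y} → D x → D y → x ~ y
  D⇒~ Dx Dy z = trans (Dx z) (sym (Dy z))

  D-⊤ : D ⊤
  D-⊤ = D-⊕¬ (D-⊃ point)

  D-¬⊤ : D (¬ ⊤)
  D-¬⊤ = D-¬⊕¬ (D-⊃ point)

  ⊤-constant : ∀ x → (x ⊃ x) ⊕ ¬ (x ⊃ x) ≈ ⊤
  ⊤-constant x = ~-¬~⇒≈ (D⇒~ (D-⊕¬ (D-⊃ x)) D-⊤) (D⇒~ (D-¬⊕¬ (D-⊃ x)) D-¬⊤)

  ~⇒≈ : ∀ {x y} → x ≤ₜ ⊤ → y ≤ₜ ⊤ → x ~ y → x ≈ y
  ~⇒≈ x≤⊤ y≤⊤ x~y = ~-¬~⇒≈ x~y (D⇒~ (D¬ x≤⊤) (D¬ y≤⊤))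
    where
    D¬ : ∀ {x} → x ≤ₜ ⊤ → D (¬ x)
    D¬ x≤⊤ = D-up (≤ₜ⇒≼ (¬-antitoneₜ x≤⊤)) D-¬⊤

module _ {c ℓ} (B : ImplicativeBilattice c ℓ) where

  open ImplicativeBilattice B
  open ImplicativeBilatticeProperties B

  private
    Carrier⁻ : Set (c ⊔ˡ ℓ)
    Carrier⁻ = Σ[ a ∈ Carrier ] a ≤ₜ ⊤

    infixr 7 _∧⁻_
    infixr 6 _∨⁻_
    _∧⁻_ _∨⁻_ _∖⁻_ : Op₂ Carrier⁻
    (a , a≤⊤) ∧⁻ (b , _)   = a ∧ b , ≤ₜ-trans (x∧y≤ₜx a b) a≤⊤
    (a , a≤⊤) ∨⁻ (b , b≤⊤) = a ∨ b , ∨-leastₜ a≤⊤ b≤⊤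
    (a , _)   ∖⁻ (b , _)   = (a ⊃ (a ∧ b)) ∧ ⊤ , x∧y≤ₜy (a ⊃ (a ∧ b)) ⊤

    ⊤⁻ : Carrier⁻
    ⊤⁻ = ⊤ , ≤ₜ-refl

    _≈⁻_ : Rel Carrier⁻ ℓ
    _≈⁻_ = _≈_ on proj₁

    lift : (x y : Carrier⁻) → proj₁ x ~ proj₁ y → x ≈⁻ y
    lift (_ , x≤⊤) (_ , y≤⊤) = ~⇒≈ x≤⊤ y≤⊤

    isLattice⁻ : LatticeStructures.IsLattice _≈⁻_ _∨⁻_ _∧⁻_
    isLattice⁻ = record
      { isEquivalence = On.isEquivalence proj₁ isEquivalence
      ; ∨-comm        = λ _ _ → ∨-comm _ _
      ; ∨-assoc       = λ _ _ _ → ∨-assoc _ _ _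
      ; ∨-cong        = ∨-cong
      ; ∧-comm        = λ _ _ → ∧-comm _ _
      ; ∧-assoc       = λ _ _ _ → ∧-assoc _ _ _
      ; ∧-cong        = ∧-cong
      ; absorptive    = (λ _ _ → ∨-absorbs-∧ _ _) , (λ _ _ → ∧-absorbs-∨ _ _)
      }

    lattice⁻ : Lattice (c ⊔ˡ ℓ) ℓ
    lattice⁻ = record { isLattice = isLattice⁻ }

    dualIsDistributive : LatticeStructures.IsDistributiveLattice _≈⁻_ _∧⁻_ _∨⁻_
    dualIsDistributive = BiasedStructures.isDistributiveLatticeʳʲᵐ record
      { isLattice    = LatticeProperties.∧-∨-isLattice lattice⁻
      ; ∨-distribʳ-∧ = λ x y z →
          lift ((y ∨⁻ z) ∧⁻ x) ((y ∧⁻ x) ∨⁻ (z ∧⁻ x)) (distribʳ (proj₁ x) (proj₁ y) (proj₁ z))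
      }
      where
      distribʳ : ∀ x y z → (y ∨ z) ∧ x ~ (y ∧ x) ∨ (z ∧ x)
      distribʳ x y z = ~-trans (≈⇒~ (∧-comm (y ∨ z) x)) (~-trans (∧-distribˡ-∨-~ x y z)
        (≈⇒~ (∨-cong (∧-comm x y) (∧-comm x z))))

    isDistributive⁻ : LatticeStructures.IsDistributiveLattice _≈⁻_ _∨⁻_ _∧⁻_
    isDistributive⁻ = DistributiveLatticeProperties.∧-∨-isDistributiveLattice
      (record { isDistributiveLattice = dualIsDistributive })

    ∧-∖-~ : ∀ a b → a ∧ ((a ⊃ (a ∧ b)) ∧ ⊤) ~ a ∧ b
    ∧-∖-~ a b = ≼-antisym
      (≼-trans (∧-monoʳ (x∧y≤x _ ⊤))
        (≼-trans (≼-reflexive (≈⇒~ (∧-comm a _))) (uncurry ≼-refl)))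
      (∧-greatest (x∧y≤x a b) (∧-greatest (curry (x∧y≤x _ a)) (D⇒≼ D-⊤)))

    ∨-∖-~ : ∀ a b → a ∨ ((a ⊃ (a ∧ b)) ∧ ⊤) ~ ⊤
    ∨-∖-~ a b = D⇒~ (D-up (peirce u (a ∧ b)) (≼⇒⊃ hyp)) D-⊤
      where
      u = a ∨ ((a ⊃ (a ∧ b)) ∧ ⊤)
      hyp : u ⊃ (a ∧ b) ≼ u
      hyp = ≼-trans
        (∧-greatest (curry (≼-trans (∧-monoʳ (x≤x∨y a _)) (uncurry ≼-refl))) (D⇒≼ D-⊤))
        (y≤x∨y a _)

    ∖⁻-relativeComplement : ∀ a b → IsRelativeComplement lattice⁻ (a ∧⁻ b) ⊤⁻ a (a ∖⁻ b)
    ∖⁻-relativeComplement a b =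
      lift (a ∧⁻ (a ∖⁻ b)) (a ∧⁻ b) (∧-∖-~ (proj₁ a) (proj₁ b)) ,
      lift (a ∨⁻ (a ∖⁻ b)) ⊤⁻       (∨-∖-~ (proj₁ a) (proj₁ b))

    relativelyComplemented⁻ : RelativelyComplemented lattice⁻
    relativelyComplemented⁻ {a} {b} {x} a≤x x≤b = (x ∖⁻ a) ∧⁻ b , meet , join
      where
      open Lattice lattice⁻ using () renaming (_≈_ to _≋_; setoid to setoid⁻)
      open ≈-Reasoning setoid⁻
      module ⁻ = LatticeStructures.IsDistributiveLattice isDistributive⁻
      x∨b≋b : x ∨⁻ b ≋ b
      x∨b≋b = ≤ₜ-antisym (∨-leastₜ x≤b ≤ₜ-refl) (y≤ₜx∨y (proj₁ x) (proj₁ b))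
      meet : x ∧⁻ ((x ∖⁻ a) ∧⁻ b) ≋ a
      meet = begin
        x ∧⁻ ((x ∖⁻ a) ∧⁻ b)   ≈⟨ ⁻.∧-assoc x (x ∖⁻ a) b ⟨
        (x ∧⁻ (x ∖⁻ a)) ∧⁻ b   ≈⟨ ⁻.∧-congʳ {b} {x ∧⁻ (x ∖⁻ a)} {x ∧⁻ a} (proj₁ (∖⁻-relativeComplement x a)) ⟩
        (x ∧⁻ a) ∧⁻ b          ≈⟨ ⁻.∧-congʳ {b} {x ∧⁻ a} {a} (trans (∧-comm _ _) (sym a≤x)) ⟩
        a ∧⁻ b                 ≈⟨ ≤ₜ-trans a≤x x≤b ⟨
        a                      ∎
      join : x ∨⁻ ((x ∖⁻ a) ∧⁻ b) ≋ b
      join = begin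
        x ∨⁻ ((x ∖⁻ a) ∧⁻ b)          ≈⟨ ⁻.∨-distribˡ-∧ x (x ∖⁻ a) b ⟩
        (x ∨⁻ (x ∖⁻ a)) ∧⁻ (x ∨⁻ b)   ≈⟨ ∧-cong (proj₂ (∖⁻-relativeComplement x a)) x∨b≋b ⟩
        ⊤⁻ ∧⁻ b                       ≈⟨ trans (∧-comm ⊤ (proj₁ b)) (sym (proj₂ b)) ⟩
        b                             ∎

  G-obj : ClassicalImplicativeLattice (c ⊔ˡ ℓ) ℓ
  G-obj = record
    { Carrier                = Carrier⁻
    ; _≈_                    = _≈⁻_
    ; _⊓_                    = _∧⁻_
    ; _⊔_                    = _∨⁻_
    ; _∖_                    = _∖⁻_
    ; 1#                     = ⊤⁻
    ; isDistributiveLattice  = isDistributive⁻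
    ; 1-maximum              = proj₂
    ; relativelyComplemented = λ {a} {b} {x} → relativelyComplemented⁻ {a} {b} {x}
    ; ∖-cong                 = λ p q → ∧-cong (⊃-cong p (∧-cong p q)) refl
    ; ∖-relativeComplement   = ∖⁻-relativeComplement
    }

module _ {c ℓ} {A B : ImplicativeBilattice c ℓ} (k : ImplicativeBilatticeHom A B) where

  private
    module A = ImplicativeBilattice A
    module B = ImplicativeBilattice B
  open ImplicativeBilatticeHom k
  open B using (_≈_)
  open ≈-Reasoning B.setoid

  ⊤-homo : ⟦ A.⊤ ⟧ ≈ B.⊤
  ⊤-homo = begin
    ⟦ t A.⊕ A.¬ t ⟧               ≈⟨ ⊕-homo t (A.¬ t) ⟩
    ⟦ t ⟧ B.⊕ ⟦ A.¬ t ⟧           ≈⟨ B.⊕-cong B.refl (¬-homo t) ⟩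
    ⟦ t ⟧ B.⊕ B.¬ ⟦ t ⟧           ≈⟨ B.⊕-cong ⊃h (B.¬-cong ⊃h) ⟩
    (p B.⊃ p) B.⊕ B.¬ (p B.⊃ p)   ≈⟨ ImplicativeBilatticeProperties.⊤-constant B p ⟩
    B.⊤                           ∎
    where
    t = A.point A.⊃ A.point
    p = ⟦ A.point ⟧
    ⊃h : ⟦ t ⟧ ≈ p B.⊃ p
    ⊃h = ⊃-homo A.point A.point

  ≤⊤-homo : ∀ {a} → a A.≤ₜ A.⊤ → ⟦ a ⟧ B.≤ₜ B.⊤
  ≤⊤-homo {a} a≤⊤ = begin
    ⟦ a ⟧               ≈⟨ ⟦⟧-cong a≤⊤ ⟩
    ⟦ a A.∧ A.⊤ ⟧       ≈⟨ ∧-homo a A.⊤ ⟩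
    ⟦ a ⟧ B.∧ ⟦ A.⊤ ⟧   ≈⟨ B.∧-cong B.refl ⊤-homo ⟩
    ⟦ a ⟧ B.∧ B.⊤       ∎

  ∖-homo : ∀ a b → ⟦ (a A.⊃ (a A.∧ b)) A.∧ A.⊤ ⟧ ≈
                   (⟦ a ⟧ B.⊃ (⟦ a ⟧ B.∧ ⟦ b ⟧)) B.∧ B.⊤
  ∖-homo a b = B.trans (∧-homo _ _) (B.∧-cong
    (B.trans (⊃-homo _ _) (B.⊃-cong B.refl (∧-homo _ _))) ⊤-homo)

  G-hom : ClassicalImplicativeLatticeHom (G-obj A) (G-obj B)
  G-hom = record
    { ⟦_⟧         = λ (a , a≤⊤) → ⟦ a ⟧ , ≤⊤-homo a≤⊤
    ; latticeHomo = record
      { isRelHomomorphism = record { cong = ⟦⟧-cong }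
      ; ∧-homo            = λ _ _ → ∧-homo _ _
      ; ∨-homo            = λ _ _ → ∨-homo _ _
      }
    ; ∖-homo      = λ _ _ → ∖-homo _ _
    ; 1-homo      = ⊤-homo
    }

-- An element of the universe of B⁻ carries a proof that it is below ⊤, which
-- raises the level of the carrier from c to c ⊔ ℓ.
G : ∀ c ℓ → Functor (ImpBiLat c ℓ) (CILat (c ⊔ˡ ℓ) ℓ)
G c ℓ = record
  { F₀       = G-obj
  ; F₁       = G-hom
  ; F₁-cong  = λ k≈k′ (a , _) → k≈k′ a
  ; identity = λ {B} _ → ImplicativeBilattice.refl B
  ; homo     = λ {_} {_} {C} _ _ _ → ImplicativeBilattice.refl C
  }

module _ {c ℓ} (B : ImplicativeBilattice c ℓ) where

  open ImplicativeBilattice B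
  open ImplicativeBilatticeProperties B using (x∧y≤ₜy)

  f-map : Carrier → ImplicativeBilattice.Carrier (F-obj (G-obj B))
  f-map a = (a ∧ ⊤ , x∧y≤ₜy a ⊤) , (¬ a ∧ ⊤ , x∧y≤ₜy (¬ a) ⊤)

module _ {c ℓ} (L : ClassicalImplicativeLattice c ℓ) where

  open ClassicalImplicativeLattice L
  open ClassicalImplicativeLatticeProperties L

  g-map : Carrier → ClassicalImplicativeLattice.Carrier (G-obj (F-obj L))
  g-map a = (a , 1#) ,
    ≤-trans (1-maximum a) (≤-trans (≤-reflexive (sym (⊓-idem 1#))) (y≤x∨y _ _)) ,
    antisym (x≤x∨y 1# _) (1-maximum _)

{-# OPTIONS --safe #-}

-- An element x of an implicative bilattice is determined by the ~-classes of x
-- and ¬ x, and below ⊤ the relation ~ is equality.  Since x ∧ ⊤ ~ x, the map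
-- f x = ⟨ x ∧ ⊤ , ¬ x ∧ ⊤ ⟩ is therefore injective, and the homomorphism laws
-- need only be checked up to ~.  It is onto because a ⊗ ¬ b is sent to ⟨ a , b ⟩:
-- in L ⊙ L this is ⟨ a , 1 ⟩ ⊗ ⟨ 1 , b ⟩ = ⟨ a , b ⟩.  For g, the elements of
-- L ⊙ L below ⊤ are exactly those with second component 1.
module Submission where

open import Defs
import Algebra.Definitions as AlgebraDefinitions
open import Algebra.Lattice.Bundles using (Lattice)
import Algebra.Lattice.Properties.Lattice as LatticeProperties
import Algebra.Morphism.Definitions as MorphismDefinitions
open import Data.Product.Base using (Σ-syntax; _×_; _,_; proj₁; proj₂)
open import Function.Definitions using (Injective; StrictlyInverseˡ)
open import Level using (Level; _⊔_)
open import Relation.Binary.Bundles using (Setoid)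
open import Relation.Binary.Core using (Rel)
import Relation.Binary.Lattice as OrderTheoretic
import Relation.Binary.Reasoning.Setoid as ≈-Reasoning

-- Inverses of bijective homomorphisms

module InverseHomomorphism
  {a b ℓ₁ ℓ₂} {A : Set a} (_≈ᴬ_ : Rel A ℓ₁) (S : Setoid b ℓ₂)
  (⟦_⟧ : A → Setoid.Carrier S) (s : Setoid.Carrier S → A)
  (injective : Injective _≈ᴬ_ (Setoid._≈_ S) ⟦_⟧)
  (section : StrictlyInverseˡ (Setoid._≈_ S) ⟦_⟧ s)
  where

  open Setoid S using (_≈_; sym; trans) renaming (Carrier to B)
  private
    module To = MorphismDefinitions A B _≈_
    module From = MorphismDefinitions B A _≈ᴬ_
  open AlgebraDefinitions _≈_ using (Congruent₁; Congruent₂)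

  -- By injectivity an equation in `A` can be checked after applying `⟦_⟧`, where `section` cancels
  -- `s`. This makes `s` respect equality, and the same argument transports each homomorphism law to
  -- `s`.
  inverse-cong : ∀ {x y} → x ≈ y → s x ≈ᴬ s y
  inverse-cong x≈y = injective (trans (section _) (trans x≈y (sym (section _))))

  inverse-homo₀ : ∀ ∙ᴬ ∙ᴮ → To.Homomorphic₀ ⟦_⟧ ∙ᴬ ∙ᴮ → From.Homomorphic₀ s ∙ᴮ ∙ᴬ
  inverse-homo₀ _ ∙ᴮ homo = injective (trans (section ∙ᴮ) (sym homo))

  inverse-homo₁ : ∀ ∙ᴬ ∙ᴮ → Congruent₁ ∙ᴮ →
                  To.Homomorphic₁ ⟦_⟧ ∙ᴬ ∙ᴮ → From.Homomorphic₁ s ∙ᴮ ∙ᴬ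
  inverse-homo₁ _ _ cong homo y = injective (trans (section _)
    (trans (cong (sym (section y))) (sym (homo (s y)))))

  inverse-homo₂ : ∀ ∙ᴬ ∙ᴮ → Congruent₂ ∙ᴮ →
                  To.Homomorphic₂ ⟦_⟧ ∙ᴬ ∙ᴮ → From.Homomorphic₂ s ∙ᴮ ∙ᴬ
  inverse-homo₂ _ _ cong homo x y = injective (trans (section _)
    (trans (cong (sym (section x)) (sym (section y))) (sym (homo (s x) (s y)))))

module _ {c ℓ} {A B : ImplicativeBilattice c ℓ} (k : ImplicativeBilatticeHom A B) where

  private
    module A = ImplicativeBilattice A
    module B = ImplicativeBilattice B
  open ImplicativeBilatticeHom k

  bijective⇒isIsoᴮ : (s : B.Carrier → A.Carrier) →
                     Injective A._≈_ B._≈_ ⟦_⟧ → StrictlyInverseˡ B._≈_ ⟦_⟧ s →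
                     Category.IsIso (ImpBiLat c ℓ) k
  bijective⇒isIsoᴮ s injective section = record
    { inverse  = record
      { ⟦_⟧    = s
      ; homoₜ  = record
        { isRelHomomorphism = record { cong = inverse-cong }
        ; ∧-homo            = inverse-homo₂ A._∧_ B._∧_ B.∧-cong ∧-homo
        ; ∨-homo            = inverse-homo₂ A._∨_ B._∨_ B.∨-cong ∨-homo
        }
      ; homoₖ  = record
        { isRelHomomorphism = record { cong = inverse-cong }
        ; ∧-homo            = inverse-homo₂ A._⊗_ B._⊗_ B.⊗-cong ⊗-homo
        ; ∨-homo            = inverse-homo₂ A._⊕_ B._⊕_ B.⊕-cong ⊕-homo
        }
      ; ⊃-homo = inverse-homo₂ A._⊃_ B._⊃_ B.⊃-cong ⊃-homo
      ; ¬-homo = inverse-homo₁ A.¬_ B.¬_ B.¬-cong ¬-homo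
      }
    ; inverseˡ = λ x → injective (section ⟦ x ⟧)
    ; inverseʳ = section
    }
    where open InverseHomomorphism A._≈_ B.setoid ⟦_⟧ s injective section

module _ {c ℓ} {L M : ClassicalImplicativeLattice c ℓ}
         (h : ClassicalImplicativeLatticeHom L M) where

  private
    module L = ClassicalImplicativeLattice L
    module M = ClassicalImplicativeLattice M
    module h = ClassicalImplicativeLatticeHom h
  open h using (⟦_⟧)

  bijective⇒isIsoᴸ : (s : M.Carrier → L.Carrier) →
                     Injective L._≈_ M._≈_ ⟦_⟧ → StrictlyInverseˡ M._≈_ ⟦_⟧ s →
                     Category.IsIso (CILat c ℓ) h
  bijective⇒isIsoᴸ s injective section = record
    { inverse  = record
      { ⟦_⟧         = s
      ; latticeHomo = record
        { isRelHomomorphism = record { cong = inverse-cong }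
        ; ∧-homo            = inverse-homo₂ L._⊓_ M._⊓_ M.⊓-cong h.⊓-homo
        ; ∨-homo            = inverse-homo₂ L._⊔_ M._⊔_ M.⊔-cong h.⊔-homo
        }
      ; ∖-homo      = inverse-homo₂ L._∖_ M._∖_ M.∖-cong h.∖-homo
      ; 1-homo      = inverse-homo₀ L.1# M.1# h.1-homo
      }
    ; inverseˡ = λ x → injective (section ⟦ x ⟧)
    ; inverseʳ = section
    }
    where open InverseHomomorphism L._≈_ M.setoid ⟦_⟧ s injective section

-- Negation on the truth and knowledge lattices

module DeMorgan {c ℓ} (B : ImplicativeBilattice c ℓ) where

  open ImplicativeBilattice B
  open ImplicativeBilatticeProperties B
  open OrderTheoretic.Lattice (LatticeProperties.∨-∧-orderTheoreticLattice latticeₜ)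
    using () renaming (x≤x∨y to x≤ₜx∨y)
  open OrderTheoretic.Lattice (LatticeProperties.∨-∧-orderTheoreticLattice latticeₖ)
    using () renaming (∨-least to ⊕-leastₖ)

  ¬-swapₜ : ∀ {x y} → ¬ x ≤ₜ y → ¬ y ≤ₜ x
  ¬-swapₜ {x} ¬x≤y = ≤ₜ-trans (¬-antitoneₜ ¬x≤y) (≤ₜ-reflexive (¬-involutive x))

  ¬-swapₖ : ∀ {x y} → x ≤ₖ ¬ y → ¬ x ≤ₖ y
  ¬-swapₖ {x} {y} x≤¬y = ≤ₖ-trans (¬-monotoneₖ x≤¬y) (≤ₖ-reflexive (¬-involutive y))

  -- An antitone involution is an order-reversing automorphism for `≤ₜ`, so it exchanges meets and
  -- joins.
  ¬-∧ : ∀ x y → ¬ (x ∧ y) ≈ ¬ x ∨ ¬ y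
  ¬-∧ x y = ≤ₜ-antisym
    (¬-swapₜ (∧-greatestₜ (¬-swapₜ (x≤ₜx∨y (¬ x) (¬ y))) (¬-swapₜ (y≤ₜx∨y (¬ x) (¬ y)))))
    (∨-leastₜ (¬-antitoneₜ (x∧y≤ₜx x y)) (¬-antitoneₜ (x∧y≤ₜy x y)))

  ¬-∨ : ∀ x y → ¬ (x ∨ y) ≈ ¬ x ∧ ¬ y
  ¬-∨ x y = begin
    ¬ (x ∨ y)             ≈⟨ ¬-cong (∨-cong (¬-involutive x) (¬-involutive y)) ⟨
    ¬ (¬ ¬ x ∨ ¬ ¬ y)     ≈⟨ ¬-cong (¬-∧ (¬ x) (¬ y)) ⟨
    ¬ ¬ (¬ x ∧ ¬ y)       ≈⟨ ¬-involutive (¬ x ∧ ¬ y) ⟩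
    ¬ x ∧ ¬ y             ∎
    where open ≈-Reasoning setoid

  ¬-homo-⊗ : ∀ x y → ¬ (x ⊗ y) ≈ ¬ x ⊗ ¬ y
  ¬-homo-⊗ x y = trans (¬-cong (sym (¬-⊗ x y))) (¬-involutive (¬ x ⊗ ¬ y))

  -- A monotone involution is an order automorphism for `≤ₖ`, and such maps preserve joins.
  ¬-homo-⊕ : ∀ x y → ¬ (x ⊕ y) ≈ ¬ x ⊕ ¬ y
  ¬-homo-⊕ x y = ≤ₖ-antisym
    (¬-swapₖ (⊕-leastₖ (≤-¬ (x≤ₖx⊕y (¬ x) (¬ y))) (≤-¬ (y≤ₖx⊕y (¬ x) (¬ y)))))
    (⊕-leastₖ (¬-monotoneₖ (x≤ₖx⊕y x y)) (¬-monotoneₖ (y≤ₖx⊕y x y)))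
    where
    ≤-¬ : ∀ {u v} → ¬ u ≤ₖ v → u ≤ₖ ¬ v
    ≤-¬ {u} ¬u≤v = ≤ₖ-trans (≤ₖ-reflexive (sym (¬-involutive u))) (¬-monotoneₖ ¬u≤v)

-- Implication and designated elements modulo `~`

module _ {c ℓ} (B : ImplicativeBilattice c ℓ) where

  open ImplicativeBilattice B
  open ImplicativeBilatticeProperties B

  ∨~⊕ : ∀ x y → x ∨ y ~ x ⊕ y
  ∨~⊕ x y z = trans (IB4-∨ x y z) (IB4-⊕ x y z)

  -- The definition of `~` varies only the consequent, so it gives no direct replacement of `y` by
  -- `y′`. The adjunction between `∧` and `⊃` for `≼` does.
  ⊃-resp-~ : ∀ {x x′ y y′} → x ~ x′ → y ~ y′ → x ⊃ y ~ x′ ⊃ y′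
  ⊃-resp-~ x~x′ y~y′ = ≼-antisym (mono (~-sym x~x′) y~y′) (mono x~x′ (~-sym y~y′))
    where
    mono : ∀ {x x′ y y′} → x′ ~ x → y ~ y′ → x ⊃ y ≼ x′ ⊃ y′
    mono x′~x y~y′ = curry (≼-trans (∧-monoʳ (≼-reflexive x′~x))
      (≼-trans (uncurry ≼-refl) (≼-reflexive y~y′)))

  -- Reconciles the relative complement of `G-obj B`, built from `a ⊃ (a ∧ b)`, with plain
  -- implication.
  ⊃-∧ : ∀ x y → x ⊃ (x ∧ y) ~ x ⊃ y
  ⊃-∧ x y = ≼-antisym
    (curry (≼-trans (uncurry ≼-refl) (x∧y≤y x y)))
    (curry (∧-greatest (x∧y≤y (x ⊃ y) x) (uncurry ≼-refl)))

  ¬-⊃ : ∀ x y → ¬ (x ⊃ y) ~ x ∧ ¬ y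
  ¬-⊃ = IB6

  -- Designated elements form the top class of `≼`, hence the unit of `∧` modulo `~`.
  ∧-identityʳ-D : ∀ x {y} → D y → x ∧ y ~ x
  ∧-identityʳ-D x {y} Dy = ≼-antisym (x∧y≤x x y) (∧-greatest ≼-refl (D⇒≼ Dy))

  ∧⊤~ : ∀ x → x ∧ ⊤ ~ x
  ∧⊤~ x = ∧-identityʳ-D x D-⊤

  -- Antitonicity puts `¬ ⊤`, which is designated, below `¬ x`; in L ⊙ L this is the second
  -- component being 1.
  D-¬ : ∀ {x} → x ≤ₜ ⊤ → D (¬ x)
  D-¬ x≤⊤ = D-up (≤ₜ⇒≼ (¬-antitoneₜ x≤⊤)) D-¬⊤

-- The natural isomorphism `f`

module _ {c ℓ} (B : ImplicativeBilattice (c ⊔ ℓ) ℓ) where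

  open ImplicativeBilattice B
  open ImplicativeBilatticeProperties B
  open DeMorgan B
  private
    module L = ClassicalImplicativeLattice (G-obj B)
    module FG = ImplicativeBilattice (F-obj (G-obj B))

    lift : (x y : L.Carrier) → proj₁ x ~ proj₁ y → x L.≈ y
    lift (_ , x≤⊤) (_ , y≤⊤) = ~⇒≈ x≤⊤ y≤⊤

    lift² : (p q : FG.Carrier) → proj₁ (proj₁ p) ~ proj₁ (proj₁ q) →
            proj₁ (proj₂ p) ~ proj₁ (proj₂ q) → p FG.≈ q
    lift² (p₁ , p₂) (q₁ , q₂) p₁~q₁ p₂~q₂ = lift p₁ q₁ p₁~q₁ , lift p₂ q₂ p₂~q₂

    t : ∀ x → x ~ x ∧ ⊤
    t x = ~-sym (∧⊤~ B x)

    f-cong : ∀ {x y} → x ≈ y → f-map B x FG.≈ f-map B y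
    f-cong x≈y = ∧-cong x≈y refl , ∧-cong (¬-cong x≈y) refl

  -- The codomain is written through the functors rather than as F-obj (G-obj B)
  -- so that f-hom matches Family syntactically: conversion checking would
  -- otherwise unfold both bilattices field by field and not finish.
  f-hom : ImplicativeBilatticeHom B (Functor.F₀ (F (c ⊔ ℓ) ℓ ∘F G (c ⊔ ℓ) ℓ) B)
  f-hom = record
    { ⟦_⟧    = f-map B
    ; homoₜ  = record
      { isRelHomomorphism = record { cong = f-cong }
      ; ∧-homo = λ x y → lift² (f-map B (x ∧ y)) (f-map B x FG.∧ f-map B y)
          (~-trans (∧⊤~ B _) (∧-resp-~ (t x) (t y)))
          (~-trans (∧⊤~ B _) (~-trans (≈⇒~ (¬-∧ x y)) (∨-resp-~ (t (¬ x)) (t (¬ y)))))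
      ; ∨-homo = λ x y → lift² (f-map B (x ∨ y)) (f-map B x FG.∨ f-map B y)
          (~-trans (∧⊤~ B _) (∨-resp-~ (t x) (t y)))
          (~-trans (∧⊤~ B _) (~-trans (≈⇒~ (¬-∨ x y)) (∧-resp-~ (t (¬ x)) (t (¬ y)))))
      }
    ; homoₖ  = record
      { isRelHomomorphism = record { cong = f-cong }
      ; ∧-homo = λ x y → lift² (f-map B (x ⊗ y)) (f-map B x FG.⊗ f-map B y)
          (~-trans (∧⊤~ B _) (⊗~ x y))
          (~-trans (∧⊤~ B _) (~-trans (≈⇒~ (¬-homo-⊗ x y)) (⊗~ (¬ x) (¬ y))))
      ; ∨-homo = λ x y → lift² (f-map B (x ⊕ y)) (f-map B x FG.⊕ f-map B y)
          (~-trans (∧⊤~ B _) (⊕~ x y))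
          (~-trans (∧⊤~ B _) (~-trans (≈⇒~ (¬-homo-⊕ x y)) (⊕~ (¬ x) (¬ y))))
      }
    ; ⊃-homo = λ x y → lift² (f-map B (x ⊃ y)) (f-map B x FG.⊃ f-map B y)
        -- The first component on the right is the relative complement of `x ∧ ⊤` and `y ∧ ⊤`, which
        -- already ends in `∧ ⊤`; that factor is therefore kept on both sides.
        (∧-resp-~ (~-trans (⊃-resp-~ B (t x) (t y)) (~-sym (⊃-∧ B (x ∧ ⊤) (y ∧ ⊤)))) ~-refl)
        (~-trans (∧⊤~ B _) (~-trans (¬-⊃ B x y) (∧-resp-~ (t x) (t (¬ y)))))
    ; ¬-homo = λ x → refl , ∧-cong (¬-involutive x) refl
    }
    where
    ⊗~ : ∀ x y → x ⊗ y ~ (x ∧ ⊤) ∧ (y ∧ ⊤)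
    ⊗~ x y = ~-trans (~-sym (∧~⊗ x y)) (∧-resp-~ (t x) (t y))
    ⊕~ : ∀ x y → x ⊕ y ~ (x ∧ ⊤) ∨ (y ∧ ⊤)
    ⊕~ x y = ~-trans (~-sym (∨~⊕ B x y)) (∨-resp-~ (t x) (t y))

  f⁻¹ : FG.Carrier → Carrier
  f⁻¹ ((a , _) , (b , _)) = a ⊗ ¬ b

  f-injective : Injective _≈_ FG._≈_ (f-map B)
  f-injective {x} {y} (p , q) = ~-¬~⇒≈
    (~-trans (t x) (~-trans (≈⇒~ p) (∧⊤~ B y)))
    (~-trans (t (¬ x)) (~-trans (≈⇒~ q) (∧⊤~ B (¬ y))))

  f-f⁻¹ : StrictlyInverseˡ FG._≈_ (f-map B) f⁻¹
  f-f⁻¹ p@((a , a≤⊤) , (b , b≤⊤)) = lift² (f-map B (f⁻¹ p)) p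
    -- As `b` lies below `⊤`, `¬ b` is designated and acts as a unit for `a`.
    (~-trans (∧⊤~ B _) (~-trans (~-sym (∧~⊗ a (¬ b))) (∧-identityʳ-D B a (D-¬ B b≤⊤))))
    -- Negation exchanges the roles: `¬ a` is now the designated unit and `¬ ¬ b` remains.
    (begin
      ¬ (a ⊗ ¬ b) ∧ ⊤   ≈⟨ ∧⊤~ B _ ⟩
      ¬ (a ⊗ ¬ b)       ≈⟨ ≈⇒~ (trans (¬-homo-⊗ a (¬ b)) (⊗-comm (¬ a) (¬ ¬ b))) ⟩
      ¬ ¬ b ⊗ ¬ a       ≈⟨ ∧~⊗ (¬ ¬ b) (¬ a) ⟨
      ¬ ¬ b ∧ ¬ a       ≈⟨ ∧-identityʳ-D B (¬ ¬ b) (D-¬ B a≤⊤) ⟩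
      ¬ ¬ b             ≈⟨ ≈⇒~ (¬-involutive b) ⟩
      b                 ∎)
    where open ≈-Reasoning (Lattice.setoid ~-lattice)

-- Carrier levels of the form `c ⊔ ℓ` are fixed when `G` joins `ℓ` to them, so `F ∘F G` is an
-- endofunctor here.
f-isNaturalIsomorphism : ∀ c ℓ →
  IsNaturalIsomorphism (Id (ImpBiLat (c ⊔ ℓ) ℓ)) (F (c ⊔ ℓ) ℓ ∘F G (c ⊔ ℓ) ℓ) (f-hom {c} {ℓ})
f-isNaturalIsomorphism c ℓ = record
  { natural = λ {_} {B} k a →
      let open ImplicativeBilattice B
          open ImplicativeBilatticeHom k
          -- A homomorphism preserves `⊤`, the value of a constant term, and so commutes with `∧ ⊤`;
          -- the second component also uses `¬-homo`.
          ∧⊤-homo : ∀ x → ⟦ x ⟧ ∧ ⊤ ≈ ⟦ _ ⟧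
          ∧⊤-homo x = trans (∧-cong refl (sym (⊤-homo k))) (sym (∧-homo x _))
      in  ∧⊤-homo a , trans (∧-cong (sym (¬-homo a)) refl) (∧⊤-homo _)
  ; isIso   = λ B → bijective⇒isIsoᴮ (f-hom {c} B) (f⁻¹ {c} B) (f-injective {c} B) (f-f⁻¹ {c} B)
  }

-- The natural isomorphism `g`

module _ {c ℓ} (L : ClassicalImplicativeLattice (c ⊔ ℓ) ℓ) where

  open ClassicalImplicativeLattice L renaming (_⊔_ to _⊔ᴸ_)
  open ClassicalImplicativeLatticeProperties L
  private module GF = ClassicalImplicativeLattice (G-obj (F-obj L))

  -- The order `≤ₜ` is reversed in the second component, so being below `⊤` bounds `b` from below by
  -- `(1# ⊓ 1#) ⊔ (1# ∖ 1#)`, which is 1.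
  proj₂≈1 : (p : GF.Carrier) → proj₂ (proj₁ p) ≈ 1#
  proj₂≈1 ((a , b) , (_ , b≈b⊔t)) = antisym (1-maximum b) (≤-trans
    (≤-reflexive (sym (⊓-idem 1#))) (≤-trans (x≤x∨y (1# ⊓ 1#) (1# ∖ 1#))
    (≤-trans (y≤x∨y b _) (≤-reflexive (sym b≈b⊔t)))))

  ≈-from-proj₁ : (p q : GF.Carrier) → proj₁ (proj₁ p) ≈ proj₁ (proj₁ q) → p GF.≈ q
  ≈-from-proj₁ p q p₁≈q₁ = p₁≈q₁ , trans (proj₂≈1 p) (sym (proj₂≈1 q))

  g-hom : ClassicalImplicativeLatticeHom L (Functor.F₀ (G (c ⊔ ℓ) ℓ ∘F F (c ⊔ ℓ) ℓ) L)
  g-hom = record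
    { ⟦_⟧         = g-map L
    ; latticeHomo = record
      { isRelHomomorphism = record { cong = λ x≈y → x≈y , refl }
      ; ∧-homo = λ x y → ≈-from-proj₁ (g-map L (x ⊓ y)) (g-map L x GF.⊓ g-map L y) refl
      ; ∨-homo = λ x y → ≈-from-proj₁ (g-map L (x ⊔ᴸ y)) (g-map L x GF.⊔ g-map L y) refl
      }
    ; ∖-homo      = λ x y → ≈-from-proj₁ (g-map L (x ∖ y)) (g-map L x GF.∖ g-map L y)
        -- In `GF` the first component of the relative complement is `x ∖ (x ⊓ y)` met with the
        -- first component of `⊤`.
        (trans (∖≈∖⊓ x y) (trans (1-maximum _) (⊓-congˡ 1≈t)))
    ; 1-homo      = ≈-from-proj₁ (g-map L 1#) GF.1# 1≈t
    }
    where
    -- The right-hand side is the first component of `⊤` in `F-obj L`, as computed from the point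
    -- `(1# , 1#)`.
    1≈t : 1# ≈ (1# ∖ 1#) ⊔ᴸ (1# ⊓ 1#)
    1≈t = antisym (≤-trans (≤-reflexive (sym (∖-diag 1#))) (x≤x∨y _ _)) (1-maximum _)
    ∖≈∖⊓ : ∀ x y → x ∖ y ≈ x ∖ (x ⊓ y)
    ∖≈∖⊓ x y = antisym
      (curry (∧-greatest (x∧y≤y _ x) (uncurry ≤-refl)))
      (curry (≤-trans (uncurry ≤-refl) (x∧y≤y x y)))

g-isNaturalIsomorphism : ∀ c ℓ →
  IsNaturalIsomorphism (Id (CILat (c ⊔ ℓ) ℓ)) (G (c ⊔ ℓ) ℓ ∘F F (c ⊔ ℓ) ℓ) (g-hom {c} {ℓ})
g-isNaturalIsomorphism c ℓ = record
  { natural = λ {L} {M} h a →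
      let open ClassicalImplicativeLattice M using (refl; sym)
      -- The two sides are ⟨h a, 1⟩ and ⟨h a, h 1⟩.
      in  refl , sym (ClassicalImplicativeLatticeHom.1-homo h)
  ; isIso   = λ L → let open ClassicalImplicativeLattice L using (refl; sym) in
      -- The inverse is the first projection, since the second component of any element below `⊤` is
      -- 1.
      bijective⇒isIsoᴸ (g-hom {c} L) (λ p → proj₁ (proj₁ p)) proj₁
        (λ p → refl , sym (proj₂≈1 {c} L p))
  }

theorem5p6p9 :
    ∀ (c ℓ : Level) →
    let 𝐂𝐋 = CILat (c ⊔ ℓ) ℓ
        𝐈𝐁 = ImpBiLat (c ⊔ ℓ) ℓ
        𝐅  = F (c ⊔ ℓ) ℓ
        𝐆  = G (c ⊔ ℓ) ℓ
    in
    (Σ[ f ∈ Family (Id 𝐈𝐁) (𝐅 ∘F 𝐆) ]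
       (∀ B a → let open ImplicativeBilattice (F-obj (G-obj B)) using (_≈_) in
                ImplicativeBilatticeHom.⟦_⟧ (f B) a ≈ f-map B a)
       × IsNaturalIsomorphism (Id 𝐈𝐁) (𝐅 ∘F 𝐆) f)
    × (Σ[ g ∈ Family (Id 𝐂𝐋) (𝐆 ∘F 𝐅) ]
       (∀ L a → let open ClassicalImplicativeLattice (G-obj (F-obj L)) using (_≈_) in
                ClassicalImplicativeLatticeHom.⟦_⟧ (g L) a ≈ g-map L a)
       × IsNaturalIsomorphism (Id 𝐂𝐋) (𝐆 ∘F 𝐅) g)
    × NaturallyEquivalent 𝐂𝐋 𝐈𝐁
theorem5p6p9 c ℓ =
  (f-hom {c} , (λ B a → ImplicativeBilattice.refl (F-obj (G-obj B)) {f-map B a}) ,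
   f-isNaturalIsomorphism c ℓ) ,
  (g-hom {c} , (λ L a → ClassicalImplicativeLattice.refl (G-obj (F-obj L)) {g-map L a}) ,
   g-isNaturalIsomorphism c ℓ) ,
  record
    { to      = F (c ⊔ ℓ) ℓ
    ; from    = G (c ⊔ ℓ) ℓ
    ; from∘to = g-hom {c} , g-isNaturalIsomorphism c ℓ
    ; to∘from = f-hom {c} , f-isNaturalIsomorphism c ℓ
    }
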